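{- If $G$ is an almost opposable finite simple graph, then the first player wins SNORT on $G$.
   Context: All graphs are finite and simple. $N[v]$ denotes the closed neighbourhood of $v$. An opposition of a graph $G$ is an automorphism $f$ of $G$ of order two, in the sense $f\circ f=\mathrm{id}$, such that $f(v)\notin N[v]$ for all $v\in V(G)$. A graph is opposable if it has an opposition (the empty graph is vacuously opposable). A set $S\subseteq V(G)$ is admissible if $u\in S\subseteq N[u]$ for some $u\in V(G)$. The graph $G$ is almost opposable if there is an admissible set $S$ such that $G-S$ is opposable. SNORT on a graph $G$: two players, Left and Right, move alternately; all vertices start uncoloured. On her turn Left colours an uncoloured vertex blue that is not adjacent to any red vertex; on his turn Right colours an uncoloured vertex red that is not adjacent to any blue vertex. A player unable to move on their turn loses. "The first player wins SNORT on $G$" means that the player who moves first has a winning strategy (whether that player is Left or Right). -}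

module Defs where

open import Data.Fin.Base using (Fin)
open import Data.Fin.Properties using (inj⇒≟)
open import Data.Maybe.Base using (Maybe; just; nothing)
open import Data.Nat.Base using (ℕ)
open import Data.Product.Base using (Σ-syntax; ∃-syntax; _×_; _,_)
open import Data.Refinement.Base using (Refinement; value)
open import Data.Sum.Base using (_⊎_)
open import Function.Base using (_∘_; _on_)
open import Function.Bundles using (_⇔_; _↔_)
open import Function.Definitions using (Bijective)
open import Function.Properties.Inverse using (↔⇒↣)
open import Level using (0ℓ)
open import Relation.Binary.Core using (Rel)
open import Relation.Binary.Definitions
  using (DecidableEquality; Irreflexive; Symmetric)
open import Relation.Binary.PropositionalEquality.Core using (_≡_; _≢_; cong)
open import Relation.Nullary.Decidable.Core using (yes; no)
open import Relation.Unary using (Pred; _∈_; _∉_; _⊆_)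

record SimpleGraph : Set₁ where
  infix 4 _~_
  field
    V        : Set
    _~_      : Rel V 0ℓ
    ~-sym    : Symmetric _~_
    ~-irrefl : Irreflexive _≡_ _~_

  N[_] : V → Pred V 0ℓ
  N[ v ] w = w ≡ v ⊎ v ~ w

open SimpleGraph using (V)

Finite : Set → Set
Finite A = ∃[ n ] (A ↔ Fin n)

-- The subgraph induced on the complement of S. Membership proofs in a
-- Refinement are irrelevant, so two vertices of G - S are equal as soon as
-- they are equal as vertices of G.
infixl 6 _-_
_-_ : (G : SimpleGraph) → Pred (V G) 0ℓ → SimpleGraph
G - S = record
  { V        = Refinement (V G) (_∉ S)
  ; _~_      = _~_ on value
  ; ~-sym    = ~-sym
  ; ~-irrefl = ~-irrefl ∘ cong value
  }
  where open SimpleGraph G hiding (V)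

module _ (G : SimpleGraph) where
  open SimpleGraph G hiding (V)

  record IsAutomorphism (f : V G → V G) : Set where
    field
      bijective : Bijective _≡_ _≡_ f
      adjacency : ∀ u v → u ~ v ⇔ f u ~ f v

  record IsOpposition (f : V G → V G) : Set where
    field
      isAutomorphism : IsAutomorphism f
      involutive     : ∀ v → f (f v) ≡ v
      opposed        : ∀ v → f v ∉ N[ v ]

  Opposable : Set
  Opposable = Σ[ f ∈ (V G → V G) ] IsOpposition f

  Admissible : Pred (V G) 0ℓ → Set
  Admissible S = ∃[ u ] (u ∈ S × S ⊆ N[ u ])

AlmostOpposable : SimpleGraph → Set₁
AlmostOpposable G = Σ[ S ∈ Pred (V G) 0ℓ ] (Admissible G S × Opposable (G - S))

data Player : Set where
  Left Right : Player

opponent : Player → Player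
opponent Left  = Right
opponent Right = Left

data Colour : Set where
  blue red : Colour

colour : Player → Colour
colour Left  = blue
colour Right = red

-- Finiteness is used here only to decide equality of vertices when
-- a vertex is coloured.
module Snort (G : SimpleGraph) (finite : Finite (V G)) where
  open SimpleGraph G hiding (V)

  _≟_ : DecidableEquality (V G)
  _≟_ = let (_ , V↔Fin) = finite in inj⇒≟ (↔⇒↣ V↔Fin)

  -- nothing marks an uncoloured vertex.
  Position : Set
  Position = V G → Maybe Colour

  start : Position
  start _ = nothing

  Legal : Player → Position → V G → Set
  Legal p c v =
    c v ≡ nothing × (∀ w → v ~ w → c w ≢ just (colour (opponent p)))

  play : Player → V G → Position → Position
  play p v c w with w ≟ v
  ... | yes _ = just (colour p)
  ... | no  _ = c w

  -- An element of WinsToMove p c is a winning strategy, presented as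
  -- a well-founded tree, for p from position c with p to move: it names
  -- a legal move and a way to continue after it. WinsAwaiting p c is the
  -- same with the opponent of p to move, and has a continuation for each
  -- legal reply; if there is no reply, the opponent has lost.
  mutual
    data WinsToMove (p : Player) (c : Position) : Set where
      move : ∀ v → Legal p c v → WinsAwaiting p (play p v c) → WinsToMove p c

    data WinsAwaiting (p : Player) (c : Position) : Set where
      await : (∀ v → Legal (opponent p) c v →
                 WinsToMove p (play (opponent p) v c)) →
              WinsAwaiting p c

  FirstPlayerWins : Set
  FirstPlayerWins = ∀ (p : Player) → WinsToMove p start

{-# OPTIONS --safe #-}

-- The first player p colours the centre u of the admissible set S. From then
-- on the opponent can colour nothing in N[u], hence nothing in S, and p
-- answers every move x in G - S by f x. If a neighbour of f x had the
-- opponent's colour, then its image under f would be a neighbour of x with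
-- the colour of p, so x would not have been a legal move.
module Submission where

open import Data.Bool.Base using (Bool; true)
open import Data.Empty using (⊥-elim; ⊥-elim-irr)
open import Data.Fin.Base using (Fin)
open import Data.Fin.Subset using (Subset; _⊂_) renaming (_∈_ to _∈ₛ_)
open import Data.Fin.Subset.Induction using (⊂-wellFounded)
open import Data.Fin.Subset.Properties using (⊂-trans)
open import Data.Irrelevant using ([_])
open import Data.Maybe.Base using (just; nothing; is-nothing; map)
open import Data.Product.Base using (_,_; proj₁; proj₂)
open import Data.Refinement.Base using (value; _,_)
open import Data.Refinement.Properties using (value-injective)
open import Data.Sum.Base using (inj₁; inj₂)
open import Data.Vec.Base using (tabulate)
open import Data.Vec.Properties using ([]=⇒lookup; lookup⇒[]=; lookup∘tabulate)
open import Function.Base using (_∘_)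
open import Function.Bundles using (Equivalence; Inverse; _⇔_; mk⇔)
open import Induction.WellFounded using (Acc; acc)
open import Relation.Binary.PropositionalEquality
  using (_≡_; _≢_; refl; sym; trans; cong; subst; module ≡-Reasoning)
open import Relation.Nullary.Decidable.Core using (Dec; yes; no)
open import Relation.Unary using (Pred; _∈_; _∉_; _⊆_)
open import Level using (0ℓ)

open import Defs

-- Boolean tables as subsets, and the exchange of colours

∈-tabulate : ∀ {n} (f : Fin n → Bool) {i} → i ∈ₛ tabulate f ⇔ f i ≡ true
∈-tabulate f {i} = mk⇔
  (trans (sym (lookup∘tabulate f i)) ∘ []=⇒lookup)
  (lookup⇒[]= i (tabulate f) ∘ trans (lookup∘tabulate f i))

-- Under `map`, this lets a single equation relate mirror images whether they are blue, red or
-- uncoloured.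
swap : Colour → Colour
swap blue = red
swap red  = blue

swap-colour : ∀ p → swap (colour p) ≡ colour (opponent p)
swap-colour Left  = refl
swap-colour Right = refl

swap-colour-opponent : ∀ p → swap (colour (opponent p)) ≡ colour p
swap-colour-opponent Left  = refl
swap-colour-opponent Right = refl

colour-opponent≢ : ∀ p → just (colour p) ≢ just (colour (opponent p))
colour-opponent≢ Left  ()
colour-opponent≢ Right ()

-- Effect of a move and termination of the game

module Play (G : SimpleGraph) (finite : Finite (SimpleGraph.V G)) where
  open SimpleGraph G
  open Snort G finite

  private
    n  = proj₁ finite
    V↔ = proj₂ finite
    open Inverse V↔ using (to; from; strictlyInverseʳ)

  play-at : ∀ p v c → play p v c v ≡ just (colour p)
  play-at p v c with v ≟ v
  ... | yes _  = refl
  ... | no v≢v = ⊥-elim (v≢v refl)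

  play-elsewhere : ∀ p {v w} c → w ≢ v → play p v c w ≡ c w
  play-elsewhere p {v} {w} c w≢v with w ≟ v
  ... | yes w≡v = ⊥-elim (w≢v w≡v)
  ... | no _    = refl

  -- Transported to `Fin n`, where strict inclusion is known to be well-founded; this is the
  -- termination measure.
  uncoloured : Position → Subset n
  uncoloured c = tabulate (is-nothing ∘ c ∘ from)

  uncoloured-play-⊂ : ∀ p {v} c → c v ≡ nothing →
                      uncoloured (play p v c) ⊂ uncoloured c
  uncoloured-play-⊂ p {v} c cv≡nothing =
    (λ {i} → Equivalence.from (∈-tabulate _) ∘ before (from i)
           ∘ Equivalence.to (∈-tabulate _)) ,
    -- The index of the vertex just coloured witnesses strictness: it is in the old set but not in
    -- the new one.
    to v ,
    Equivalence.from (∈-tabulate _)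
      (trans (cong (is-nothing ∘ c) (strictlyInverseʳ v))
             (cong is-nothing cv≡nothing)) ,
    λ v∈ → now-coloured
      (trans (cong (is-nothing ∘ play p v c) (sym (strictlyInverseʳ v)))
             (Equivalence.to (∈-tabulate _) v∈))
    where
    before : ∀ w → is-nothing (play p v c w) ≡ true → is-nothing (c w) ≡ true
    before w eq with w ≟ v
    before w () | yes _
    before w eq | no _ = eq

    now-coloured : is-nothing (play p v c v) ≢ true
    now-coloured eq rewrite play-at p v c with () ← eq

-- The mirror strategy for a fixed first player

module MirrorStrategy
  (G : SimpleGraph) (finite : Finite (SimpleGraph.V G))
  {S : Pred (SimpleGraph.V G) 0ℓ} {u : SimpleGraph.V G}
  (u∈S : u ∈ S) (S⊆N[u] : S ⊆ SimpleGraph.N[_] G u)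
  {f : SimpleGraph.V (G - S) → SimpleGraph.V (G - S)}
  (opposition : IsOpposition (G - S) f)
  (p : Player)
  where

  open SimpleGraph G
  open Snort G finite
  open Play G finite
  open IsOpposition opposition
  open IsAutomorphism isAutomorphism using (adjacency)

  private
    q = opponent p
    V′ = SimpleGraph.V (G - S)

  value≢u : (x : V′) → value x ≢ u
  value≢u (_ , [ x∉S ]) refl = ⊥-elim-irr (x∉S u∈S)

  f-opposed : ∀ x → value (f x) ≢ value x
  f-opposed x eq = opposed x (inj₁ (value-injective eq))

  -- The invariant whenever `q` is to move. As `mirror` says nothing about `S`, `avoids-S` ensures
  -- that every vertex coloured by `q` has a mirror image.
  record Mirrored (c : Position) : Set where
    field
      centre   : c u ≡ just (colour p)
      mirror   : ∀ x → c (value (f x)) ≡ map swap (c (value x))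
      avoids-S : ∀ {w} → c w ≡ just (colour q) → w ∉ S

  -- Only `u` is coloured, and it lies in `S`, so on `G - S` the mirror equation compares `nothing`
  -- with `nothing`.
  opening : Mirrored (play p u start)
  opening = record
    { centre   = play-at p u start
    ; mirror   = λ x → trans (untouched (f x))
                             (sym (cong (map swap) (untouched x)))
    ; avoids-S = λ {w} eq _ → no-q w eq
    }
    where
    untouched : (x : V′) → play p u start (value x) ≡ nothing
    untouched x = play-elsewhere p start (value≢u x)

    no-q : ∀ w → play p u start w ≢ just (colour q)
    no-q w eq with w ≟ u
    ... | yes _ = colour-opponent≢ p eq
    no-q w () | no _

  module _ {c : Position} (mirrored : Mirrored c) where
    open Mirrored mirrored

    reply-avoids-S : ∀ {v} → Legal q c v → v ∉ S
    reply-avoids-S {v} (free , safe) v∈S with S⊆N[u] v∈S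
    ... | inj₁ refl with () ← trans (sym free) centre
    ... | inj₂ u~v = safe u (~-sym u~v) (trans centre p≡qq)
      where
      -- `opponent (opponent p)` does not reduce for a variable `p`; swapping colours twice
      -- identifies it with `p`.
      p≡qq : just (colour p) ≡ just (colour (opponent q))
      p≡qq = cong just (trans (sym (swap-colour-opponent p)) (swap-colour q))

    module _ (x : V′) (legal : Legal q c (value x)) where
      private
        c₁ = play q (value x) c
        c₂ = play p (value (f x)) c₁

      -- Before the reply `f x` was as uncoloured as `x`, and the reply leaves it so because `f` has
      -- no fixed point.
      mirror-free : c₁ (value (f x)) ≡ nothing
      mirror-free = trans (play-elsewhere q c (f-opposed x))
        (trans (mirror x) (cong (map swap) (proj₁ legal)))

      mirror-legal : Legal p c₁ (value (f x))
      mirror-legal = mirror-free , safe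
        where
        open ≡-Reasoning

        safe : ∀ w → value (f x) ~ w → c₁ w ≢ just (colour q)
        safe w fx~w eq with w ≟ value x
        -- The vertex just coloured by `q` is no obstacle: an opposition never maps `x` to a
        -- neighbour.
        ... | yes refl = opposed x (inj₂ (~-sym fx~w))
        -- Here `w` had the colour of `q` before the reply, so it lies outside `S` and has an image
        -- `f y`. Since `f` carries `x` and `f y` to `f x` and `w`, this image is a neighbour of
        -- `x`; it has the colour of `p`, against the legality of `x`.
        ... | no _     = proj₂ legal (value (f y)) x~fy (begin
          c (value (f y))                ≡⟨ mirror y ⟩
          map swap (c w)                 ≡⟨ cong (map swap) eq ⟩
          just (swap (colour q))         ≡⟨ cong just (swap-colour q) ⟩
          just (colour (opponent q))     ∎)
          where
          y : V′
          y = w , [ avoids-S eq ]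

          x~fy : value x ~ value (f y)
          x~fy = Equivalence.from (adjacency x (f y))
            (subst (value (f x) ~_) (cong value (sym (involutive y))) fx~w)

      c₂-at-x : c₂ (value x) ≡ just (colour q)
      c₂-at-x = trans (play-elsewhere p c₁ (f-opposed x ∘ sym))
                      (play-at q (value x) c)

      c₂-at-fx : c₂ (value (f x)) ≡ just (colour p)
      c₂-at-fx = play-at p (value (f x)) c₁

      c₂-elsewhere : ∀ {w} → w ≢ value x → w ≢ value (f x) → c₂ w ≡ c w
      c₂-elsewhere w≢x w≢fx =
        trans (play-elsewhere p c₁ w≢fx) (play-elsewhere q c w≢x)

      -- The round changes colours only at `x` and `f x`, which `f` interchanges and which receive
      -- opposite colours.
      mirrored-round : Mirrored c₂
      mirrored-round = record
        { centre   = trans (c₂-elsewhere (value≢u x ∘ sym) (value≢u (f x) ∘ sym))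
                           centre
        ; mirror   = λ y → mirror₂ y (value y ≟ value x) (value y ≟ value (f x))
        ; avoids-S = λ {w} → avoids-S₂ (w ≟ value x) (w ≟ value (f x))
        }
        where
        open ≡-Reasoning

        mirror₂ : ∀ y → Dec (value y ≡ value x) → Dec (value y ≡ value (f x)) →
                  c₂ (value (f y)) ≡ map swap (c₂ (value y))
        mirror₂ y (yes y≡x) _ with refl ← value-injective {v = y} {w = x} y≡x = begin
          c₂ (value (f x))         ≡⟨ c₂-at-fx ⟩
          just (colour p)          ≡⟨ cong just (swap-colour-opponent p) ⟨
          just (swap (colour q))   ≡⟨ cong (map swap) c₂-at-x ⟨
          map swap (c₂ (value x))  ∎
        mirror₂ y (no _) (yes y≡fx) with refl ← value-injective {v = y} {w = f x} y≡fx = begin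
          c₂ (value (f (f x)))         ≡⟨ cong (c₂ ∘ value) (involutive x) ⟩
          c₂ (value x)                 ≡⟨ c₂-at-x ⟩
          just (colour q)              ≡⟨ cong just (swap-colour p) ⟨
          just (swap (colour p))       ≡⟨ cong (map swap) c₂-at-fx ⟨
          map swap (c₂ (value (f x)))  ∎
        -- As an involution, `f` also preserves the complement of the pair `x`, `f x`, so neither
        -- `y` nor `f y` was recoloured.
        mirror₂ y (no y≢x) (no y≢fx) = begin
          c₂ (value (f y))         ≡⟨ c₂-elsewhere fy≢x fy≢fx ⟩
          c (value (f y))          ≡⟨ mirror y ⟩
          map swap (c (value y))   ≡⟨ cong (map swap) (c₂-elsewhere y≢x y≢fx) ⟨
          map swap (c₂ (value y))  ∎
          where
          fy≡z⇒y≡fz : ∀ {z} → value (f y) ≡ value z → value y ≡ value (f z)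
          fy≡z⇒y≡fz eq = cong value
            (trans (sym (involutive y)) (cong f (value-injective eq)))

          fy≢x : value (f y) ≢ value x
          fy≢x = y≢fx ∘ fy≡z⇒y≡fz

          fy≢fx : value (f y) ≢ value (f x)
          fy≢fx eq = y≢x (trans (fy≡z⇒y≡fz eq) (cong value (involutive x)))

        avoids-S₂ : ∀ {w} → Dec (w ≡ value x) → Dec (w ≡ value (f x)) →
                    c₂ w ≡ just (colour q) → w ∉ S
        avoids-S₂ (yes refl) _ _ = reply-avoids-S legal
        avoids-S₂ (no _) (yes refl) eq =
          ⊥-elim (colour-opponent≢ p (trans (sym c₂-at-fx) eq))
        avoids-S₂ (no w≢x) (no w≢fx) eq =
          avoids-S (trans (sym (c₂-elsewhere w≢x w≢fx)) eq)

  -- Induction on the set of uncoloured vertices, which loses `x` and `f x` in each round. If `q`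
  -- has no legal move, there is nothing to answer and `p` has won.
  mirrored-wins : ∀ {c} → Acc _⊂_ (uncoloured c) → Mirrored c → WinsAwaiting p c
  mirrored-wins {c} (acc rec) mirrored = await λ v legal →
    let x : V′
        -- The reply lies outside `S`, so it is a vertex of `G - S` and `f` applies to it.
        x = v , [ reply-avoids-S mirrored legal ]
        c₁ = play q v c
        smaller = ⊂-trans
          (uncoloured-play-⊂ p c₁ (mirror-free mirrored x legal))
          (uncoloured-play-⊂ q c (proj₁ legal))
    in move (value (f x)) (mirror-legal mirrored x legal)
         (mirrored-wins (rec smaller) (mirrored-round mirrored x legal))

  first-player-wins : WinsToMove p start
  first-player-wins =
    move u (refl , λ _ _ ()) (mirrored-wins (⊂-wellFounded _) opening)

lemma4p2 : (G : SimpleGraph) (finite : Finite (SimpleGraph.V G)) →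
    AlmostOpposable G → Snort.FirstPlayerWins G finite
lemma4p2 G finite (S , (u , u∈S , S⊆N[u]) , f , opposition) =
  MirrorStrategy.first-player-wins G finite u∈S S⊆N[u] opposition
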